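{- For any set $\mathcal{O}$ of upwards closed modalities, the logical equivalence $\equiv_{\mathcal{V}}$ (on closed values and on closed computations of each type) is identical to applicative $\mathcal{O}$-bisimilarity.
   Context: Language: types $\tau ::= \mathbf{1} \mid \mathbf{N} \mid \tau \to \tau'$; signature $\Sigma$ of effect operations with arities $\alpha^n\to\alpha$, $\mathbf{N}\times\alpha^n\to\alpha$, $\alpha^{\mathbf{N}}\to\alpha$ or $\mathbf{N}\times\alpha^{\mathbf{N}}\to\alpha$. Values $V ::= * \mid Z \mid S(V) \mid \lambda x{:}\tau.M \mid x$; computations $M ::= VW \mid \mathbf{return}\,V \mid \mathbf{let}\ M\Rightarrow x\ \mathbf{in}\ N \mid \mathbf{fix}(V) \mid \mathbf{case}\ V\ \mathbf{of}\ \{Z\Rightarrow M; S(x)\Rightarrow N\} \mid \sigma(M_0,\dots) \mid \sigma(V;M_0,\dots) \mid \sigma(V)\mid\sigma(V;W)$, simply typed call-by-value. $\mathit{Val}(\tau)$, $\mathit{Com}(\tau)$: closed values/computations; $\overline{n}=S^n(Z)$. Effect trees $TX$: possibly infinite trees with leaves $\bot$ or elements of $X$ and internal nodes labelled by effect operations (or $\sigma_m$, $m\in\mathbb{N}$, for arities with a $\mathbf{N}$ parameter) with $n$ or $\mathbb{N}$-many children; $t\le t'$ iff $t$ results from $t'$ by replacing subtrees with $\bot$. Each $M\in\mathit{Com}(\tau)$ has an operational effect tree $|M|\in T(\mathit{Val}(\tau))$ from call-by-value evaluation (leaves = returned values, nodes = effect operations encountered, $\bot$ = divergence). Modalities: set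 $\mathcal{O}$, each $o$ with $[\![o]\!]\subseteq T\mathbf{1}$; $t[\in P]\in T\mathbf{1}$ replaces leaves in $P$ by $*$, other $X$-leaves by $\bot$; $o(A)=\{t\mid t[\in A]\in[\![o]\!]\}$. Upwards closed: $[\![o]\!]$ upward closed under $\le$. Logic $\mathcal{V}$: value formulas $VF(\tau)$, computation formulas $CF(\tau)$: $\{n\}\in VF(\mathbf{N})$; $(V\mapsto\Phi)\in VF(\tau\to\tau')$ for $V\in\mathit{Val}(\tau)$, $\Phi\in CF(\tau')$; $o\,\phi\in CF(\tau)$; closed under arbitrary $\bigwedge,\bigvee,\neg$. Semantics: $W\models\{n\}$ iff $W=\overline{n}$; $W\models(V\mapsto\Phi)$ iff $WV\models\Phi$; $M\models o\phi$ iff $|M|[\in\{V\mid V\models\phi\}]\in[\![o]\!]$; connectives classical. $\equiv_{\mathcal{V}}$: same satisfied formulas. Relator: $R[A]=\{y\mid\exists x\in A,\ xRy\}$; $t\,\mathcal{O}(R)\,t'$ iff $\forall A\ \forall o\in\mathcal{O}$, $t\in o(A)\Rightarrow t'\in o(R[A])$. An applicative $\mathcal{O}$-simulation is a family $R^v_\tau\subseteq\mathit{Val}(\tau)^2$, $R^c_\tau\subseteq\mathit{Com}(\tau)^2$ with: (1) $V R^v_{\mathbf{N}} W\Rightarrow V=W$; (2) $M R^c_\tau N\Rightarrow |M|\,\mathcal{O}(R^v_\tau)\,|N|$; (3) $V R^v_{\tau'\to\tau} W\Rightarrow \forall U\in\mathit{Val}(\tau')$, $VU\,R^c_\tau\,WU$.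 An applicative $\mathcal{O}$-bisimulation is a symmetric applicative $\mathcal{O}$-simulation; applicative $\mathcal{O}$-bisimilarity is the largest one. -}

module Defs where

open import Axiom.ExcludedMiddle using (ExcludedMiddle)
open import Data.Bool.Base using (if_then_else_)
open import Data.Fin.Base using (fromℕ<)
open import Data.List.Base using (List; []; _∷_; [_]; _∷ʳ_)
open import Data.List.Membership.Propositional using (_∈_)
open import Data.List.Relation.Binary.Subset.Propositional using (_⊆_)
open import Data.List.Relation.Unary.Any using (here; there)
open import Data.Maybe.Base using (Maybe; just; nothing; _>>=_)
open import Data.Nat.Base using (ℕ; zero; suc; _<_)
open import Data.Nat.Properties using (_<?_)
open import Data.Product.Base using (Σ-syntax; ∃-syntax; _×_; _,_)
open import Data.Unit.Base using (⊤; tt)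
open import Data.Vec.Base using (Vec; []; _∷_; lookup)
open import Function.Base using (_∘_)
open import Function.Bundles using (_⇔_)
open import Level using (Level; Setω; 0ℓ; _⊔_) renaming (suc to lsuc)
open import Relation.Binary.Core using (Rel)
open import Relation.Binary.Definitions using (Symmetric)
open import Relation.Binary.PropositionalEquality using (_≡_; refl)
open import Relation.Nullary.Decidable.Core using (Dec; yes; no; does)
open import Relation.Nullary.Negation.Core using (¬_)
open import Relation.Unary using (Pred)

-- The metatheory of the development is classical: whether a computation
-- diverges and whether a leaf lies in a given set are decided by excluded
-- middle, which is passed around as an explicit hypothesis.
Classical : Setω
Classical = ∀ {ℓ} → ExcludedMiddle ℓ

private
  variable
    ℓ p : Level

-- αⁿ → α,  N × αⁿ → α,  α^N → α  and  N × α^N → α.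
data Arity : Set where
  fin    : ℕ → Arity
  N×fin  : ℕ → Arity
  fun    : Arity
  N×fun  : Arity

record Signature : Set₁ where
  field
    Op : Set
    ar : Op → Arity

Param : Arity → Set
Param (fin _)   = ⊤
Param (N×fin _) = ℕ
Param fun       = ⊤
Param N×fun     = ℕ

-- Child a i: a node of arity a has an i-th child.
Child : Arity → ℕ → Set
Child (fin n)   i = i < n
Child (N×fin n) i = i < n
Child fun       i = ⊤
Child N×fun     i = ⊤

child? : ∀ a i → Dec (Child a i)
child? (fin n)   i = i <? n
child? (N×fin n) i = i <? n
child? fun       i = yes tt
child? N×fun     i = yes tt

infixr 7 _⇒_

data Ty : Set where
  𝟏 N : Ty
  _⇒_ : Ty → Ty → Ty

Ctx : Set
Ctx = List Ty

private
  variable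
    Γ Δ   : Ctx
    τ ρ υ : Ty
    a     : Arity
    n     : ℕ

module _ (Sg : Signature) where
  open Signature Sg

  data Label (X : Set) : Set where
    leaf : X → Label X
    op   : (σ : Op) → Param (ar σ) → Label X

  -- A possibly infinite tree is a partial labelling of addresses (the list
  -- of child indices met when descending from the root).  The leaves ⊥ are
  -- the root, if unlabelled, and the unlabelled children of operation nodes.
  record T (X : Set) : Set where
    field
      label  : List ℕ → Maybe (Label X)
      closed : ∀ q i {l} → label (q ∷ʳ i) ≡ just l →
               ∃[ σ ] ∃[ m ] label q ≡ just (op σ m) × Child (ar σ) i

  open T public

  -- Replacing subtrees by ⊥ is the same as restricting the labelling.  In
  -- particular _≤_ relates trees with equal labellings in both directions,
  -- so upwards closed sets do not distinguish them.
  infix 4 _≤_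

  _≤_ : ∀ {X} → Rel (T X) 0ℓ
  t ≤ t′ = ∀ q {l} → label t q ≡ just l → label t′ q ≡ just l

  data Node (X S : Set) : Set where
    leaf : X → Node X S
    op   : (σ : Op) → Param (ar σ) → (∀ i → Child (ar σ) i → S) → Node X S

  module _ {X S : Set} (next : S → Maybe (Node X S)) where

    rootLabel : Maybe (Node X S) → Maybe (Label X)
    rootLabel (just (leaf x))   = just (leaf x)
    rootLabel (just (op σ m _)) = just (op σ m)
    rootLabel nothing           = nothing

    descend : Maybe (Node X S) → ℕ → Maybe S
    descend (just (leaf _))   i = nothing
    descend (just (op σ _ k)) i with child? (ar σ) i
    ... | yes c = just (k i c)
    ... | no  _ = nothing
    descend nothing           i = nothing

    unfoldLabel : S → List ℕ → Maybe (Label X)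
    unfoldLabel s []      = rootLabel (next s)
    unfoldLabel s (i ∷ q) = descend (next s) i >>= λ s′ → unfoldLabel s′ q

    unfoldClosed : ∀ s q i {l} → unfoldLabel s (q ∷ʳ i) ≡ just l →
                   ∃[ σ ] ∃[ m ] unfoldLabel s q ≡ just (op σ m) × Child (ar σ) i
    unfoldClosed s [] i eq with next s
    ... | just (op σ m k) with child? (ar σ) i
    ...   | yes c = σ , m , refl , c
    unfoldClosed s (j ∷ q) i eq with descend (next s) j
    ... | just s′ = unfoldClosed s′ q i eq

    unfold : S → T X
    unfold s = record { label = unfoldLabel s ; closed = unfoldClosed s }

  mutual
    data ValΓ (Γ : Ctx) : Ty → Set where
      var : τ ∈ Γ → ValΓ Γ τ
      ⋆   : ValΓ Γ 𝟏
      Z   : ValΓ Γ N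
      S   : ValΓ Γ N → ValΓ Γ N
      ƛ   : ComΓ (τ ∷ Γ) ρ → ValΓ Γ (τ ⇒ ρ)

    data ComΓ (Γ : Ctx) : Ty → Set where
      _·_     : ValΓ Γ (τ ⇒ ρ) → ValΓ Γ τ → ComΓ Γ ρ
      return  : ValΓ Γ τ → ComΓ Γ τ
      let′_⇒_ : ComΓ Γ τ → ComΓ (τ ∷ Γ) ρ → ComΓ Γ ρ
      fix     : ValΓ Γ ((τ ⇒ ρ) ⇒ (τ ⇒ ρ)) → ComΓ Γ (τ ⇒ ρ)
      case    : ValΓ Γ N → ComΓ Γ τ → ComΓ (N ∷ Γ) τ → ComΓ Γ τ
      op      : (σ : Op) → Args Γ τ (ar σ) → ComΓ Γ τ

    data Args (Γ : Ctx) (τ : Ty) : Arity → Set where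
      fin   : Vec (ComΓ Γ τ) n → Args Γ τ (fin n)
      N×fin : ValΓ Γ N → Vec (ComΓ Γ τ) n → Args Γ τ (N×fin n)
      fun   : ValΓ Γ (N ⇒ τ) → Args Γ τ fun
      N×fun : ValΓ Γ N → ValΓ Γ (N ⇒ τ) → Args Γ τ N×fun

  infix 8 _·_

  Val Com : Ty → Set
  Val = ValΓ []
  Com = ComΓ []

  ext : Γ ⊆ Δ → (τ ∷ Γ) ⊆ (τ ∷ Δ)
  ext r (here eq) = here eq
  ext r (there x) = there (r x)

  mutual
    renᵛ : Γ ⊆ Δ → ValΓ Γ τ → ValΓ Δ τ
    renᵛ r (var x) = var (r x)
    renᵛ r ⋆       = ⋆
    renᵛ r Z       = Z
    renᵛ r (S V)   = S (renᵛ r V)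
    renᵛ r (ƛ M)   = ƛ (renᶜ (ext r) M)

    renᶜ : Γ ⊆ Δ → ComΓ Γ τ → ComΓ Δ τ
    renᶜ r (V · W)      = renᵛ r V · renᵛ r W
    renᶜ r (return V)   = return (renᵛ r V)
    renᶜ r (let′ M ⇒ P) = let′ renᶜ r M ⇒ renᶜ (ext r) P
    renᶜ r (fix V)      = fix (renᵛ r V)
    renᶜ r (case V M P) = case (renᵛ r V) (renᶜ r M) (renᶜ (ext r) P)
    renᶜ r (op σ as)    = op σ (renᵃ r as)

    renᵃ : Γ ⊆ Δ → Args Γ τ a → Args Δ τ a
    renᵃ r (fin Ms)     = fin (ren* r Ms)
    renᵃ r (N×fin V Ms) = N×fin (renᵛ r V) (ren* r Ms)
    renᵃ r (fun V)      = fun (renᵛ r V)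
    renᵃ r (N×fun V W)  = N×fun (renᵛ r V) (renᵛ r W)

    ren* : Γ ⊆ Δ → Vec (ComΓ Γ τ) n → Vec (ComΓ Δ τ) n
    ren* r []       = []
    ren* r (M ∷ Ms) = renᶜ r M ∷ ren* r Ms

  wk : ValΓ Γ τ → ValΓ (ρ ∷ Γ) τ
  wk = renᵛ there

  Sub : Ctx → Ctx → Set
  Sub Γ Δ = ∀ {τ} → τ ∈ Γ → ValΓ Δ τ

  exts : Sub Γ Δ → Sub (ρ ∷ Γ) (ρ ∷ Δ)
  exts s (here eq) = var (here eq)
  exts s (there x) = wk (s x)

  mutual
    subᵛ : Sub Γ Δ → ValΓ Γ τ → ValΓ Δ τ
    subᵛ s (var x) = s x
    subᵛ s ⋆       = ⋆
    subᵛ s Z       = Z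
    subᵛ s (S V)   = S (subᵛ s V)
    subᵛ s (ƛ M)   = ƛ (subᶜ (exts s) M)

    subᶜ : Sub Γ Δ → ComΓ Γ τ → ComΓ Δ τ
    subᶜ s (V · W)      = subᵛ s V · subᵛ s W
    subᶜ s (return V)   = return (subᵛ s V)
    subᶜ s (let′ M ⇒ P) = let′ subᶜ s M ⇒ subᶜ (exts s) P
    subᶜ s (fix V)      = fix (subᵛ s V)
    subᶜ s (case V M P) = case (subᵛ s V) (subᶜ s M) (subᶜ (exts s) P)
    subᶜ s (op σ as)    = op σ (subᵃ s as)

    subᵃ : Sub Γ Δ → Args Γ τ a → Args Δ τ a
    subᵃ s (fin Ms)     = fin (sub* s Ms)
    subᵃ s (N×fin V Ms) = N×fin (subᵛ s V) (sub* s Ms)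
    subᵃ s (fun V)      = fun (subᵛ s V)
    subᵃ s (N×fun V W)  = N×fun (subᵛ s V) (subᵛ s W)

    sub* : Sub Γ Δ → Vec (ComΓ Γ τ) n → Vec (ComΓ Δ τ) n
    sub* s []       = []
    sub* s (M ∷ Ms) = subᶜ s M ∷ sub* s Ms

  _/0 : ValΓ Γ ρ → Sub (ρ ∷ Γ) Γ
  (V /0) (here refl) = V
  (V /0) (there x)   = var x

  _[_/x] : ComΓ (ρ ∷ Γ) τ → ValΓ Γ ρ → ComΓ Γ τ
  M [ V /x] = subᶜ (V /0) M

  num : ℕ → Val N
  num zero    = Z
  num (suc k) = S (num k)

  toℕ : Val N → ℕ
  toℕ (var ())
  toℕ Z     = zero
  toℕ (S V) = suc (toℕ V)

  infix 4 _⇝_ _↣_ _⇓_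

  -- fix F ⇝ return (λ x. let F (λ y. let fix F ⇒ z in z y) ⇒ w in w x)
  unrollFix : Val ((τ ⇒ ρ) ⇒ (τ ⇒ ρ)) → Val (τ ⇒ ρ)
  unrollFix F =
    ƛ (let′ (wk F · ƛ (let′ fix (wk (wk F)) ⇒ (var (here refl) · var (there (here refl)))))
       ⇒ (var (here refl) · var (there (here refl))))

  data _⇝_ : Com τ → Com τ → Set where
    β      : {M : ComΓ [ τ ] ρ} {V : Val τ} → ƛ M · V ⇝ M [ V /x]
    case-Z : {M : Com τ} {P : ComΓ [ N ] τ} → case Z M P ⇝ M
    case-S : {V : Val N} {M : Com τ} {P : ComΓ [ N ] τ} → case (S V) M P ⇝ P [ V /x]
    fix    : {F : Val ((τ ⇒ ρ) ⇒ (τ ⇒ ρ))} → fix F ⇝ return (unrollFix F)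

  data Stack : Ty → Ty → Set where
    id     : Stack τ τ
    _∘let_ : Stack υ τ → ComΓ [ ρ ] υ → Stack ρ τ

  data Config (τ : Ty) : Set where
    ⟨_,_⟩ : Stack ρ τ → Com ρ → Config τ

  data _↣_ : Config τ → Config τ → Set where
    push : {K : Stack υ τ} {M : Com ρ} {P : ComΓ [ ρ ] υ} →
           ⟨ K , let′ M ⇒ P ⟩ ↣ ⟨ K ∘let P , M ⟩
    pop  : {K : Stack υ τ} {V : Val ρ} {P : ComΓ [ ρ ] υ} →
           ⟨ K ∘let P , return V ⟩ ↣ ⟨ K , P [ V /x] ⟩
    red  : {K : Stack ρ τ} {M M′ : Com ρ} → M ⇝ M′ → ⟨ K , M ⟩ ↣ ⟨ K , M′ ⟩

  param : Args [] τ a → Param a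
  param (fin _)     = tt
  param (N×fin V _) = toℕ V
  param (fun _)     = tt
  param (N×fun V _) = toℕ V

  child : Args [] τ a → ∀ i → Child a i → Com τ
  child (fin Ms)     i c = lookup Ms (fromℕ< c)
  child (N×fin _ Ms) i c = lookup Ms (fromℕ< c)
  child (fun V)      i _ = V · num i
  child (N×fun _ V)  i _ = V · num i

  -- c ⇓ h: in finitely many silent steps c returns or reaches an operation.
  data _⇓_ : Config τ → Node (Val τ) (Config τ) → Set where
    returns  : {V : Val τ} → ⟨ id , return V ⟩ ⇓ leaf V
    performs : {K : Stack ρ τ} {σ : Op} {as : Args [] ρ (ar σ)} →
               ⟨ K , op σ as ⟩ ⇓ op σ (param as) (λ i c → ⟨ K , child as i c ⟩)
    step     : {c c′ : Config τ} {h : Node (Val τ) (Config τ)} →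
               c ↣ c′ → c′ ⇓ h → c ⇓ h

  record Modalities : Set₁ where
    field
      Modality : Set
      ⟦_⟧      : Modality → Pred (T ⊤) 0ℓ

  UpwardsClosed : Pred (T ⊤) 0ℓ → Set
  UpwardsClosed P = ∀ {t t′} → t ≤ t′ → P t → P t′

  record TypedRel (ℓ : Level) : Set (lsuc ℓ) where
    field
      val : ∀ τ → Rel (Val τ) ℓ
      com : ∀ τ → Rel (Com τ) ℓ

  open TypedRel public

  module _ (em : Classical) where

    -- At most one h satisfies c ⇓ h, so which one em provides is immaterial.
    next : Config τ → Maybe (Node (Val τ) (Config τ))
    next c with em {P = ∃[ h ] c ⇓ h}
    ... | yes (h , _) = just h
    ... | no  _       = nothing

    ∣_∣ : Com τ → T (Val τ)
    ∣ M ∣ = unfold next ⟨ id , M ⟩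

    restrictLabel : {X : Set} → Pred X p → Label X → Maybe (Label ⊤)
    restrictLabel P (leaf x) = if does (em {P = P x}) then just (leaf tt) else nothing
    restrictLabel P (op σ m) = just (op σ m)

    restrictClosed : {X : Set} (t : T X) (P : Pred X p) → ∀ q i {l} →
                     (label t (q ∷ʳ i) >>= restrictLabel P) ≡ just l →
                     ∃[ σ ] ∃[ m ] (label t q >>= restrictLabel P) ≡ just (op σ m)
                                   × Child (ar σ) i
    restrictClosed t P q i eq with label t (q ∷ʳ i) in eq′
    ... | just _ with closed t q i eq′
    ...   | σ , m , eq″ , c rewrite eq″ = σ , m , refl , c

    _[∈_] : {X : Set} → T X → Pred X p → T ⊤
    t [∈ P ] = record
      { label  = λ q → label t q >>= restrictLabel P
      ; closed = restrictClosed t P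
      }

    module _ (𝒪 : Modalities) where
      open Modalities 𝒪

      -- lift o A is the set o(A) ⊆ T X.
      lift : {X : Set} → Modality → Pred X p → Pred (T X) 0ℓ
      lift o A t = ⟦ o ⟧ (t [∈ A ])

      mutual
        data VF : Ty → Set₁ where
          ｛_｝ : ℕ → VF N
          _↦_  : Val τ → CF ρ → VF (τ ⇒ ρ)
          ⋀ ⋁  : {I : Set} → (I → VF τ) → VF τ
          neg  : VF τ → VF τ

        data CF : Ty → Set₁ where
          mod : Modality → VF τ → CF τ
          ⋀ ⋁ : {I : Set} → (I → CF τ) → CF τ
          neg : CF τ → CF τ

      infix 4 _⊨ᵛ_ _⊨ᶜ_

      mutual
        _⊨ᵛ_ : Val τ → VF τ → Set
        W ⊨ᵛ ｛ k ｝   = W ≡ num k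
        W ⊨ᵛ (V ↦ Φ) = W · V ⊨ᶜ Φ
        W ⊨ᵛ ⋀ {I = I} φ = (i : I) → W ⊨ᵛ φ i
        W ⊨ᵛ ⋁ {I = I} φ = Σ[ i ∈ I ] W ⊨ᵛ φ i
        W ⊨ᵛ neg φ   = ¬ (W ⊨ᵛ φ)

        _⊨ᶜ_ : Com τ → CF τ → Set
        M ⊨ᶜ mod o φ = lift o (λ V → V ⊨ᵛ φ) ∣ M ∣
        M ⊨ᶜ ⋀ {I = I} Φ = (i : I) → M ⊨ᶜ Φ i
        M ⊨ᶜ ⋁ {I = I} Φ = Σ[ i ∈ I ] M ⊨ᶜ Φ i
        M ⊨ᶜ neg Φ   = ¬ (M ⊨ᶜ Φ)

      logicalEquivalence : TypedRel (lsuc 0ℓ)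
      val logicalEquivalence τ V W = (φ : VF τ) → V ⊨ᵛ φ ⇔ W ⊨ᵛ φ
      com logicalEquivalence τ M P = (Φ : CF τ) → M ⊨ᶜ Φ ⇔ P ⊨ᶜ Φ

      image : {X : Set} → Rel X ℓ → Pred X 0ℓ → Pred X ℓ
      image R A y = ∃[ x ] A x × R x y

      relator : {X : Set} → Rel X ℓ → Rel (T X) (lsuc 0ℓ)
      relator {X = X} R t t′ =
        (A : Pred X 0ℓ) (o : Modality) → lift o A t → lift o (image R A) t′

      record IsApplicativeSimulation (R : TypedRel ℓ) : Set (lsuc 0ℓ ⊔ ℓ) where
        field
          nat         : ∀ {V W} → val R N V W → V ≡ W
          computation : ∀ {τ} {M P} → com R τ M P → relator (val R τ) ∣ M ∣ ∣ P ∣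
          function    : ∀ {τ ρ} {V W} → val R (τ ⇒ ρ) V W →
                        (U : Val τ) → com R ρ (V · U) (W · U)

      record IsApplicativeBisimulation (R : TypedRel ℓ) : Set (lsuc 0ℓ ⊔ ℓ) where
        field
          simulation : IsApplicativeSimulation R
          symᵛ       : ∀ {τ} → Symmetric (val R τ)
          symᶜ       : ∀ {τ} → Symmetric (com R τ)

      infix 4 _⊆ᵗ_

      _⊆ᵗ_ : Rel (TypedRel ℓ) ℓ
      R ⊆ᵗ R′ = (∀ {τ} {V W} → val R τ V W → val R′ τ V W)
              × (∀ {τ} {M P} → com R τ M P → com R′ τ M P)

      -- The level of R and R′ is immaterial: under em every relation is
      -- equivalent to a Set-valued one.
      record IsApplicativeBisimilarity (R : TypedRel ℓ) : Set (lsuc 0ℓ ⊔ lsuc ℓ) where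
        field
          bisimulation : IsApplicativeBisimulation R
          largest      : ∀ (R′ : TypedRel ℓ) → IsApplicativeBisimulation R′ → R′ ⊆ᵗ R

{-# OPTIONS --safe #-}
-- Bisimilar programs satisfy the same formulas by induction on formulas: for
-- o φ the relator gives o of the R-image of φ, which by induction lies in φ,
-- and upward closure makes o monotone.  Conversely, to see that logical
-- equivalence is a simulation, every set A of values is saturated to a set
-- definable by a formula: x has a characteristic formula, the conjunction over
-- all y of formulas that separate x from y where there are any, and the
-- disjunction of these over x ∈ A defines the image of A under equivalence.
module Submission where

open import Defs
open import Data.Empty using (⊥)
open import Data.Maybe.Base using (just)
open import Data.Product.Base using (Σ-syntax; ∃-syntax; _×_; _,_; proj₁)
open import Function.Base using (_∘_)
open import Function.Bundles using (mk⇔; Equivalence)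
open import Function.Construct.Symmetry using (⇔-sym)
open import Level using (Level; 0ℓ) renaming (suc to lsuc)
open import Relation.Binary.Core using (Rel)
open import Relation.Binary.PropositionalEquality using (_≡_; refl; sym; trans; cong)
open import Relation.Nullary.Decidable.Core using (yes; no; decidable-stable)
open import Relation.Nullary.Negation.Core using (¬_; contradiction)
open import Relation.Unary using (Pred; _⊆_)

open Equivalence using (to)

module _ (em : Classical) (Sg : Signature) where

  num∘toℕ : (V : Val Sg N) → V ≡ num Sg (toℕ Sg V)
  num∘toℕ (var ())
  num∘toℕ Z     = refl
  num∘toℕ (S V) = cong S (num∘toℕ V)

  -- Operation labels do not depend on the predicate, and a larger one only turns `⊥` leaves into
  -- `leaf tt`. Two levels are allowed because an image under `R` lives at the level of `R`.
  [∈]-mono : ∀ {p q} {X : Set} (t : T Sg X) {P : Pred X p} {Q : Pred X q} →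
             P ⊆ Q → _≤_ Sg (_[∈_] Sg em t P) (_[∈_] Sg em t Q)
  [∈]-mono t {P} {Q} P⊆Q a eq with label t a
  ... | just (op σ m) = eq
  ... | just (leaf x) with em {P = P x} | em {P = Q x}
  ...   | yes _ | yes _ = eq
  ...   | yes p | no ¬q = contradiction (P⊆Q p) ¬q

  module _ (𝒪 : Modalities Sg)
           (up : ∀ o → UpwardsClosed Sg (Modalities.⟦_⟧ 𝒪 o)) where

    open TypedRel
    open IsApplicativeSimulation
    open IsApplicativeBisimulation

    Value Comp : Ty → Set
    Value = Val Sg
    Comp  = Com Sg

    ≡𝒱 : TypedRel Sg (lsuc 0ℓ)
    ≡𝒱 = logicalEquivalence Sg em 𝒪

    infix 4 _⊩ᵛ_ _⊩ᶜ_

    _⊩ᵛ_ : ∀ {τ} → Value τ → VF Sg em 𝒪 τ → Set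
    _⊩ᵛ_ = _⊨ᵛ_ Sg em 𝒪

    _⊩ᶜ_ : ∀ {τ} → Comp τ → CF Sg em 𝒪 τ → Set
    _⊩ᶜ_ = _⊨ᶜ_ Sg em 𝒪

    lift-mono : ∀ {p q} {X : Set} o (t : T Sg X) {P : Pred X p} {Q : Pred X q} →
                P ⊆ Q → lift Sg em 𝒪 o P t → lift Sg em 𝒪 o Q t
    lift-mono o t {P} {Q} P⊆Q = up o ([∈]-mono t {P} {Q} P⊆Q)

    module _ {ℓ : Level} {R : TypedRel Sg ℓ} (B : IsApplicativeBisimulation Sg em 𝒪 R) where

      mutual
        preservesᵛ : ∀ {τ} (φ : VF Sg em 𝒪 τ) {V W} → val R τ V W → V ⊩ᵛ φ → W ⊩ᵛ φ
        preservesᵛ ｛ k ｝  r h       = trans (sym (nat (simulation B) r)) h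
        preservesᵛ (V ↦ Φ) r h       = preservesᶜ Φ (function (simulation B) r V) h
        preservesᵛ (⋀ φ)   r h i     = preservesᵛ (φ i) r (h i)
        preservesᵛ (⋁ φ)   r (i , h) = i , preservesᵛ (φ i) r h
        -- Contraposition needs preservation from `W` back to `V`, which symmetry supplies.
        preservesᵛ (neg φ) r h       = h ∘ preservesᵛ φ (symᵛ B r)

        preservesᶜ : ∀ {τ} (Φ : CF Sg em 𝒪 τ) {M P} → com R τ M P → M ⊩ᶜ Φ → P ⊩ᶜ Φ
        preservesᶜ (mod o φ) {P = P} r h =
          lift-mono o (∣_∣ Sg em P) (λ (_ , h′ , r′) → preservesᵛ φ r′ h′)
                    (computation (simulation B) r (_⊩ᵛ φ) o h)
        preservesᶜ (⋀ Φ)   r h i     = preservesᶜ (Φ i) r (h i)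
        preservesᶜ (⋁ Φ)   r (i , h) = i , preservesᶜ (Φ i) r h
        preservesᶜ (neg Φ) r h       = h ∘ preservesᶜ Φ (symᶜ B r)

    module _ {τ : Ty} where

      Separates : VF Sg em 𝒪 τ → Rel (Value τ) 0ℓ
      Separates φ x y = x ⊩ᵛ φ × ¬ (y ⊩ᵛ φ)

      separator : (x y : Value τ) → VF Sg em 𝒪 τ
      separator x y with em {P = ∃[ φ ] Separates φ x y}
      ... | yes (φ , _) = φ
      -- The empty conjunction is truth, so `x` satisfies its separator in either case.
      ... | no  _       = ⋀ {I = ⊥} λ ()

      ⊩-separator : ∀ x y → x ⊩ᵛ separator x y
      ⊩-separator x y with em {P = ∃[ φ ] Separates φ x y}
      ... | yes (_ , h , _) = h
      ... | no  _           = λ ()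

      ⊩-separator⇒inseparable : ∀ x y → y ⊩ᵛ separator x y → ∀ φ → ¬ Separates φ x y
      ⊩-separator⇒inseparable x y h φ s with em {P = ∃[ φ ] Separates φ x y}
      ... | yes (_ , _ , ¬h) = ¬h h
      ... | no  none         = none (φ , s)

      -- One-sided inseparability suffices: a formula true of `y` only would have a negation
      -- separating `x` from `y`.
      inseparable⇒≡𝒱 : ∀ {x y} → (∀ φ → ¬ Separates φ x y) → val ≡𝒱 τ x y
      inseparable⇒≡𝒱 insep φ = mk⇔
        (λ x⊩φ → decidable-stable em λ y⊮φ → insep φ (x⊩φ , y⊮φ))
        (λ y⊩φ → decidable-stable em λ x⊮φ → insep (neg φ) (x⊮φ , λ y⊮φ → y⊮φ y⊩φ))

      -- Connectives are indexed by a `Set`, while formulas live in `Set₁`; one chosen separator per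
      -- value `y` keeps the conjunction small.
      characteristic : Value τ → VF Sg em 𝒪 τ
      characteristic x = ⋀ (separator x)

      saturation : Pred (Value τ) 0ℓ → VF Sg em 𝒪 τ
      saturation A = ⋁ {I = Σ[ x ∈ Value τ ] A x} (characteristic ∘ proj₁)

      ⊆saturation : ∀ A → A ⊆ (_⊩ᵛ saturation A)
      ⊆saturation A {x} a = (x , a) , ⊩-separator x

      saturation⊆image : ∀ A → (_⊩ᵛ saturation A) ⊆ image Sg em 𝒪 (val ≡𝒱 τ) A
      saturation⊆image A {y} ((x , a) , h) =
        x , a , inseparable⇒≡𝒱 (⊩-separator⇒inseparable x y (h y))

    ≡𝒱-isBisimulation : IsApplicativeBisimulation Sg em 𝒪 ≡𝒱
    nat (simulation ≡𝒱-isBisimulation) {V} e =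
      -- Closed values of type `N` are numerals, so a single formula `｛ k ｝` determines `V`.
      trans (num∘toℕ V) (sym (to (e ｛ toℕ Sg V ｝) (num∘toℕ V)))
    computation (simulation ≡𝒱-isBisimulation) {M = M} {P} e A o h =
      -- Since `A` need not be definable, it is enlarged to its saturation for `M`, carried to `P`
      -- by a modal formula, then moved into the image.
      lift-mono o (∣_∣ Sg em P) (saturation⊆image A)
        (to (e (mod o (saturation A))) (lift-mono o (∣_∣ Sg em M) (⊆saturation A) h))
    function (simulation ≡𝒱-isBisimulation) e U Φ = e (U ↦ Φ)
    symᵛ ≡𝒱-isBisimulation e φ = ⇔-sym (e φ)
    symᶜ ≡𝒱-isBisimulation e Φ = ⇔-sym (e Φ)

theorem2 : (em : Classical) (Sg : Signature) (𝒪 : Modalities Sg) →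
    (∀ o → UpwardsClosed Sg (Modalities.⟦_⟧ 𝒪 o)) →
    IsApplicativeBisimilarity Sg em 𝒪 (logicalEquivalence Sg em 𝒪)
theorem2 em Sg 𝒪 up = record
  { bisimulation = ≡𝒱-isBisimulation em Sg 𝒪 up
  ; largest      = λ _ B →
      (λ r φ → mk⇔ (preservesᵛ em Sg 𝒪 up B φ r) (preservesᵛ em Sg 𝒪 up B φ (symᵛ B r)))
    , (λ r Φ → mk⇔ (preservesᶜ em Sg 𝒪 up B Φ r) (preservesᶜ em Sg 𝒪 up B Φ (symᶜ B r)))
  }
  where open IsApplicativeBisimulation
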